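{- Let $(\ell,\mathcal{S},d,y)$ be a WPCS instance with $\mathcal{S}$ non-interleaving. Then there exists an integral selection $z$ for $\mathcal{S}$ with $D_{y,z}([i])\le \tfrac{d_{\max}}{2}$ for all $i\in[\ell]$, where $d_{\max}=\max_{S\in\mathcal{S}}d_S$. Moreover, such $z$ can be computed in time $O(\ell)$.
   Context: $[\ell]=\{1,\dots,\ell\}$; for $q\in\mathbb{R}^\ell$ and $U\subseteq[\ell]$, $q(U)=\sum_{i\in U}q_i$. Two disjoint sets $S_1,S_2\subseteq\mathbb{Z}_{>0}$ are interleaving if there exist $a_1,b_1\in S_1$, $a_2,b_2\in S_2$ with $a_1<a_2<b_1<b_2$ or $a_2<a_1<b_2<b_1$; a partition of $[\ell]$ is non-interleaving if no two distinct members are interleaving. For a partition $\mathcal{S}$ of $[\ell]$, a fractional selection is a vector $y\in[0,1]^\ell$ (rational) with $y(S)=1$ for all $S\in\mathcal{S}$, and an integral selection is $z\in\{0,1\}^\ell$ with $z(S)=1$ for all $S\in\mathcal{S}$. A WPCS instance is a tuple $(\ell,\mathcal{S},d,y)$ with $\ell\in\mathbb{Z}_{\ge0}$, $\mathcal{S}$ a partition of $[\ell]$, $d\in\mathbb{Q}_{\ge0}^{\mathcal{S}}$, and $y$ a fractional selection for $\mathcal{S}$. For $q\in[0,1]^\ell$ the load vector $q^d$ is $q^d_i=d_S\,q_i$ where $S\in\mathcal{S}$ contains $i$. For $I\subseteq[\ell]$ and selections $y,z$, $D_{y,z}(I)=|y^d(I)-z^d(I)|$. -}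

module Defs where

open import Algebra.Properties.CommutativeMonoid.Sum as Sum using ()
open import Data.Bool using (Bool; true; false; if_then_else_; _∧_)
open import Data.Fin using (Fin; toℕ; fromℕ<; _<_)
open import Data.Fin.Properties using (_≤?_)
open import Data.Fin.Subset using (Subset; Nonempty; _∈_)
open import Data.Nat as ℕ using (ℕ; suc)
open import Data.Product using (∃₂; ∃-syntax; _×_; proj₁)
open import Data.Rational using (ℚ; 0ℚ; 1ℚ; _+_; _*_; _-_; _≤_; _⊔_; ∣_∣)
open import Data.Rational.Properties using (+-0-commutativeMonoid; _<?_)
open import Data.Sum using (_⊎_)
open import Data.Vec as Vec using ()
open import Data.Vec.Functional using (Vector; foldr)
open import Relation.Binary.PropositionalEquality using (_≡_; _≢_)
open import Relation.Nullary using (¬_; does; yes; no)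

private
  variable
    n : ℕ

-- The ground set [ℓ] = {1,…,ℓ} is Fin ℓ; only its size and order matter.

record Partition (ℓ : ℕ) : Set where
  field
    size     : ℕ
    member   : Fin size → Subset ℓ
    nonempty : ∀ s → Nonempty (member s)
    disjoint : ∀ s t i → i ∈ member s → i ∈ member t → s ≡ t
    covering : ∀ i → ∃[ s ] i ∈ member s

  memberOf : Fin ℓ → Fin size
  memberOf i = proj₁ (covering i)

Interleaving : Subset n → Subset n → Set
Interleaving S₁ S₂ =
  ∃₂ λ a₁ b₁ → ∃₂ λ a₂ b₂ →
    (a₁ ∈ S₁ × b₁ ∈ S₁ × a₂ ∈ S₂ × b₂ ∈ S₂) ×
    ((a₁ < a₂ × a₂ < b₁ × b₁ < b₂) ⊎ (a₂ < a₁ × a₁ < b₂ × b₂ < b₁))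

NonInterleaving : Partition n → Set
NonInterleaving 𝒮 = ∀ s t → s ≢ t → ¬ Interleaving (member s) (member t)
  where open Partition 𝒮

infix 8 _⟨_⟩

_⟨_⟩ : Vector ℚ n → Subset n → ℚ
q ⟨ U ⟩ = Sum.sum +-0-commutativeMonoid (λ i → if Vec.lookup U i then q i else 0ℚ)

IsFractionalSelection : Partition n → Vector ℚ n → Set
IsFractionalSelection 𝒮 y =
  (∀ i → 0ℚ ≤ y i × y i ≤ 1ℚ) × (∀ s → y ⟨ member s ⟩ ≡ 1ℚ)
  where open Partition 𝒮

IsIntegralSelection : Partition n → Vector ℚ n → Set
IsIntegralSelection 𝒮 z =
  (∀ i → z i ≡ 0ℚ ⊎ z i ≡ 1ℚ) × (∀ s → z ⟨ member s ⟩ ≡ 1ℚ)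
  where open Partition 𝒮

upTo : Fin n → Subset n
upTo i = Vec.tabulate (λ j → does (j ≤? i))

record WPCS : Set where
  field
    ℓ            : ℕ
    𝒮            : Partition ℓ
  open Partition 𝒮 public
  field
    d            : Vector ℚ size
    d-nonneg     : ∀ s → 0ℚ ≤ d s
    y            : Vector ℚ ℓ
    y-fractional : IsFractionalSelection 𝒮 y

  load : Vector ℚ ℓ → Vector ℚ ℓ
  load q i = d (memberOf i) * q i

  D : Vector ℚ ℓ → Vector ℚ ℓ → Subset ℓ → ℚ
  D y z I = ∣ load y ⟨ I ⟩ - load z ⟨ I ⟩ ∣

  -- Starting from 0 does not change the maximum, as d is nonnegative.
  d-max : ℚ
  d-max = foldr _⊔_ 0ℚ d

-- Running time is measured on a random access machine with unit-cost
-- arithmetic, given as a small imperative language.  The memory is a family of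
-- integer arrays and a family of rational arrays.  Array names in a program are
-- literals, so a program uses only finitely many arrays; array indices are
-- computed.  Scalar variables are array cells with a literal index.

infixl 7 _⊛_
infixl 6 _⊕_ _⊖_ _⊞_ _⊟_
infix  4 _≺_ _⋖_

data NatExp : Set where
  lit  : ℕ → NatExp
  cell : ℕ → NatExp → NatExp
  _⊕_  : NatExp → NatExp → NatExp
  _⊖_  : NatExp → NatExp → NatExp

data RatExp : Set where
  lit  : ℚ → RatExp
  cell : ℕ → NatExp → RatExp
  _⊞_  : RatExp → RatExp → RatExp
  _⊟_  : RatExp → RatExp → RatExp
  _⊛_  : RatExp → RatExp → RatExp

data Test : Set where
  _≺_ : NatExp → NatExp → Test
  _⋖_ : RatExp → RatExp → Test

infixr 3 _⨾_

data Program : Set where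
  skip   : Program
  setNat : ℕ → NatExp → NatExp → Program
  setRat : ℕ → NatExp → RatExp → Program
  _⨾_    : Program → Program → Program
  if     : Test → Program → Program → Program
  while  : Test → Program → Program

record Store : Set where
  constructor store
  field
    nat : ℕ → ℕ → ℕ
    rat : ℕ → ℕ → ℚ

open Store

_[_,_]≔_ : {A : Set} → (ℕ → ℕ → A) → ℕ → ℕ → A → (ℕ → ℕ → A)
(f [ a , i ]≔ v) b j =
  if does (b ℕ.≟ a) ∧ does (j ℕ.≟ i) then v else f b j

evalℕ : NatExp → Store → ℕ
evalℕ (lit k)    σ = k
evalℕ (cell a e) σ = nat σ a (evalℕ e σ)
evalℕ (e ⊕ f)    σ = evalℕ e σ ℕ.+ evalℕ f σ
evalℕ (e ⊖ f)    σ = evalℕ e σ ℕ.∸ evalℕ f σ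

evalℚ : RatExp → Store → ℚ
evalℚ (lit q)    σ = q
evalℚ (cell a e) σ = rat σ a (evalℕ e σ)
evalℚ (e ⊞ f)    σ = evalℚ e σ + evalℚ f σ
evalℚ (e ⊟ f)    σ = evalℚ e σ - evalℚ f σ
evalℚ (e ⊛ f)    σ = evalℚ e σ * evalℚ f σ

evalTest : Test → Store → Bool
evalTest (e ≺ f) σ = does (evalℕ e σ ℕ.<? evalℕ f σ)
evalTest (e ⋖ f) σ = does (evalℚ e σ <? evalℚ f σ)

costℕ : NatExp → ℕ
costℕ (lit k)    = 1
costℕ (cell a e) = suc (costℕ e)
costℕ (e ⊕ f)    = suc (costℕ e ℕ.+ costℕ f)
costℕ (e ⊖ f)    = suc (costℕ e ℕ.+ costℕ f)

costℚ : RatExp → ℕ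
costℚ (lit q)    = 1
costℚ (cell a e) = suc (costℕ e)
costℚ (e ⊞ f)    = suc (costℚ e ℕ.+ costℚ f)
costℚ (e ⊟ f)    = suc (costℚ e ℕ.+ costℚ f)
costℚ (e ⊛ f)    = suc (costℚ e ℕ.+ costℚ f)

costTest : Test → ℕ
costTest (e ≺ f) = suc (costℕ e ℕ.+ costℕ f)
costTest (e ⋖ f) = suc (costℚ e ℕ.+ costℚ f)

infix 2 _∶_⇓_∶_

-- P ∶ σ ⇓ τ ∶ t : started in σ, the program P halts in τ after t steps.
data _∶_⇓_∶_ : Program → Store → Store → ℕ → Set where

  ⇓skip : ∀ {σ} → skip ∶ σ ⇓ σ ∶ 1

  ⇓setNat : ∀ {a i e σ} →
    setNat a i e ∶ σ
      ⇓ store (nat σ [ a , evalℕ i σ ]≔ evalℕ e σ) (rat σ)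
      ∶ suc (costℕ i ℕ.+ costℕ e)

  ⇓setRat : ∀ {a i e σ} →
    setRat a i e ∶ σ
      ⇓ store (nat σ) (rat σ [ a , evalℕ i σ ]≔ evalℚ e σ)
      ∶ suc (costℕ i ℕ.+ costℚ e)

  ⇓seq : ∀ {P Q ρ σ τ s t} →
    P ∶ ρ ⇓ σ ∶ s → Q ∶ σ ⇓ τ ∶ t → P ⨾ Q ∶ ρ ⇓ τ ∶ suc (s ℕ.+ t)

  ⇓ifTrue : ∀ {b P Q σ τ t} → evalTest b σ ≡ true →
    P ∶ σ ⇓ τ ∶ t → if b P Q ∶ σ ⇓ τ ∶ suc (costTest b ℕ.+ t)

  ⇓ifFalse : ∀ {b P Q σ τ t} → evalTest b σ ≡ false →
    Q ∶ σ ⇓ τ ∶ t → if b P Q ∶ σ ⇓ τ ∶ suc (costTest b ℕ.+ t)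

  ⇓whileTrue : ∀ {b P ρ σ τ s t} → evalTest b ρ ≡ true →
    P ∶ ρ ⇓ σ ∶ s → while b P ∶ σ ⇓ τ ∶ t →
    while b P ∶ ρ ⇓ τ ∶ suc (costTest b ℕ.+ (s ℕ.+ t))

  ⇓whileFalse : ∀ {b P σ} → evalTest b σ ≡ false →
    while b P ∶ σ ⇓ σ ∶ suc (costTest b)

toArray : {A : Set} → A → Vector A n → ℕ → A
toArray {n = n} default v k with k ℕ.<? n
... | yes k<n = v (fromℕ< k<n)
... | no  _   = default

-- The input: ℓ and |𝒮| in the first two cells of integer array 0; for each
-- element the index of its member of 𝒮 in integer array 1; d and y in rational
-- arrays 0 and 1.  All other cells are 0.
encode : WPCS → Store
encode W = store nat₀ rat₀
  where
  open WPCS W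

  nat₀ : ℕ → ℕ → ℕ
  nat₀ 0 0 = ℓ
  nat₀ 0 1 = size
  nat₀ 1 k = toArray 0 (λ i → toℕ (memberOf i)) k
  nat₀ _ _ = 0

  rat₀ : ℕ → ℕ → ℚ
  rat₀ 0 k = toArray 0ℚ d k
  rat₀ 1 k = toArray 0ℚ y k
  rat₀ _ _ = 0ℚ

-- On input W the program P halts within t steps with z in rational array 2.
OutputsWithin : Program → (W : WPCS) → Vector ℚ (WPCS.ℓ W) → ℕ → Set
OutputsWithin P W z t =
  ∃₂ λ τ s → (P ∶ encode W ⇓ τ ∶ s) × s ℕ.≤ t × (∀ i → rat τ 2 (toℕ i) ≡ z i)

{-# OPTIONS --safe #-}
-- One left-to-right scan suffices.  Keep the current prefix error E and the
-- largest demand D met so far.  On reaching an element of S, add d_S y_i to E;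
-- pick the element, subtracting d_S from E, if E would exceed D/2 or if the
-- unpicked y-mass of S has reached 1.  A pick of the first kind leaves
-- E > D/2 - d_S ≥ -D/2.  Since classes do not interleave, classes met between
-- two elements of S lie entirely between them, or avoid that interval, so E is
-- E₀ plus the contribution of S, where E₀ is the error just before the first
-- element of S.  Hence a pick of the second kind restores E₀, and after its
-- pick S keeps E at most E₀, so neither test fires twice for S.
module Submission where

open import Defs
open import Data.Bool using (Bool; true; false; if_then_else_)
open import Data.Empty using (⊥; ⊥-elim)
open import Data.Fin using (zero; suc; toℕ; fromℕ; fromℕ<; inject₁)
open import Data.Fin.Properties using (toℕ<n; toℕ-injective; toℕ-fromℕ; toℕ-fromℕ<; fromℕ<-toℕ; toℕ-inject₁)
open import Data.Fin.Subset using (_∈_)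
open import Data.Nat as ℕ using (ℕ; zero; suc; s≤s; s≤s⁻¹) renaming (_*_ to _*ℕ_)
open import Data.Nat.Properties as ℕ using (anyUpTo?)
open import Data.Product using (∃₂; ∃-syntax; _×_; _,_; proj₁; proj₂)
open import Data.Rational using (ℚ; 0ℚ; 1ℚ; ½; _+_; _-_; -_; _*_; _≤_; _<_; _⊔_; ∣_∣; nonNegative)
open import Data.Rational.Properties
open import Data.Rational.Solver using (module +-*-Solver)
open import Data.Sum using (_⊎_; inj₁; inj₂)
open import Data.Unit using (⊤)
open import Data.Vec as Vec using ()
open import Data.Vec.Functional using (Vector; foldr)
open import Data.Vec.Properties using ([]=⇒lookup; lookup⇒[]=; lookup∘tabulate)
open import Function using (_∘_; case_of_)
open import Relation.Binary.Definitions using (tri<; tri≈; tri>)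
open import Relation.Binary.PropositionalEquality using (_≡_; _≢_; refl; sym; trans; cong; cong₂; subst; subst₂; module ≡-Reasoning)
open import Relation.Nullary using (Dec; ¬_; does; yes; no; contradiction; _×-dec_)
open import Relation.Nullary.Decidable using (dec-true; dec-false)
open import Algebra.Properties.CommutativeMonoid.Sum +-0-commutativeMonoid using (sum; sum-init-last)
open Store using (nat; rat)
open +-*-Solver using (solve; con; _:=_; _:+_; _:*_; _:-_; :-_)

-- Sums over initial segments of ℕ

p≤p+q : ∀ p {q} → 0ℚ ≤ q → p ≤ p + q
p≤p+q p 0≤q = subst (_≤ p + _) (+-identityʳ p) (+-monoʳ-≤ p 0≤q)

-- Indexing by ℕ makes prefixes of different lengths terms of one sequence, with the last summand
-- split off by definition.
Σ< : (ℕ → ℚ) → ℕ → ℚ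
Σ< f zero    = 0ℚ
Σ< f (suc n) = Σ< f n + f n

Σ<-cong : ∀ {f g} n → (∀ j → j ℕ.< n → f j ≡ g j) → Σ< f n ≡ Σ< g n
Σ<-cong zero    f≗g = refl
Σ<-cong (suc n) f≗g =
  cong₂ _+_ (Σ<-cong n (λ j → f≗g j ∘ ℕ.m<n⇒m<1+n)) (f≗g n ℕ.≤-refl)

Σ<-extend : ∀ {f m n} → m ℕ.≤ n → (∀ j → m ℕ.≤ j → j ℕ.< n → f j ≡ 0ℚ) →
            Σ< f n ≡ Σ< f m
Σ<-extend {f} m≤n = go (ℕ.≤⇒≤′ m≤n)
  where
  go : ∀ {m n} → m ℕ.≤′ n → (∀ j → m ℕ.≤ j → j ℕ.< n → f j ≡ 0ℚ) → Σ< f n ≡ Σ< f m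
  go ℕ.≤′-refl               f≡0 = refl
  go (ℕ.≤′-step {n = n} m≤n) f≡0 =
    trans (cong₂ _+_ (go m≤n (λ j m≤j → f≡0 j m≤j ∘ ℕ.m<n⇒m<1+n))
                     (f≡0 n (ℕ.≤′⇒≤ m≤n) ℕ.≤-refl))
          (+-identityʳ _)

Σ<-mono : ∀ {f m n} → (∀ j → 0ℚ ≤ f j) → m ℕ.≤ n → Σ< f m ≤ Σ< f n
Σ<-mono {f} 0≤f m≤n = go (ℕ.≤⇒≤′ m≤n)
  where
  go : ∀ {m n} → m ℕ.≤′ n → Σ< f m ≤ Σ< f n
  go ℕ.≤′-refl               = ≤-refl
  go (ℕ.≤′-step {n = n} m≤n) = ≤-trans (go m≤n) (p≤p+q (Σ< f n) (0≤f n))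

-- Applied with `s` the only class whose balance differs between two positions of the scan.
Σ<-update : ∀ {f g s} n → s ℕ.< n → (∀ t → t ≢ s → g t ≡ f t) →
            Σ< g n ≡ Σ< f n + (g s - f s)
Σ<-update {f} {g} {s} (suc n) s<1+n g≗f with n ℕ.≟ s
... | yes refl = begin
  Σ< g n + g n                 ≡⟨ cong (_+ g n) (Σ<-cong n (λ t t<n → g≗f t (ℕ.<⇒≢ t<n))) ⟩
  Σ< f n + g n                 ≡⟨ solve 3 (λ a b c → a :+ b := a :+ c :+ (b :- c)) refl (Σ< f n) (g n) (f n) ⟩
  Σ< f n + f n + (g n - f n)   ∎
  where open ≡-Reasoning
... | no n≢s = begin
  Σ< g n + g n                 ≡⟨ cong₂ _+_ (Σ<-update n (ℕ.≤∧≢⇒< (s≤s⁻¹ s<1+n) (n≢s ∘ sym)) g≗f) (g≗f n n≢s) ⟩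
  Σ< f n + (g s - f s) + f n   ≡⟨ solve 3 (λ a b c → a :+ b :+ c := a :+ c :+ b) refl (Σ< f n) (g s - f s) (f n) ⟩
  Σ< f n + f n + (g s - f s)   ∎
  where open ≡-Reasoning

-- Inequalities and conditionals

*-mono-≤-nonNeg : ∀ {r p q} → 0ℚ ≤ r → p ≤ q → r * p ≤ r * q
*-mono-≤-nonNeg {r} 0≤r p≤q = *-monoˡ-≤-nonNeg r {{nonNegative 0≤r}} p≤q

≤⇒-≤0 : ∀ {p q} → p ≤ q → p - q ≤ 0ℚ
≤⇒-≤0 {p} {q} p≤q = subst (p - q ≤_) (+-inverseʳ q) (+-monoˡ-≤ (- q) p≤q)

if-yes : ∀ {A B : Set} {x y : B} (a? : Dec A) → A → (if does a? then x else y) ≡ x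
if-yes a? a = cong (if_then _ else _) (dec-true a? a)

if-no : ∀ {A B : Set} {x y : B} (a? : Dec A) → ¬ A → (if does a? then x else y) ≡ y
if-no a? ¬a = cong (if_then _ else _) (dec-false a? ¬a)

if-both : ∀ {A : Set} (P : A → Set) b {x y} → P x → P y → P (if b then x else y)
if-both P true  px py = px
if-both P false px py = py

larger-upper : ∀ {p q} (p<q? : Dec (p < q)) →
               p ≤ (if does p<q? then q else p) × q ≤ (if does p<q? then q else p)
larger-upper (yes p<q) = <⇒≤ p<q , ≤-refl
larger-upper (no p≮q)  = ≤-refl , ≮⇒≥ p≮q

-- balance k t is the excess, on class t, of the y-mass over the number of
-- picks among the first k elements; error k is the sum of d t * balance k t.
module Greedy (cls : ℕ → ℕ) (d y : ℕ → ℚ) where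

  peak : ℕ → ℚ
  peak zero    = 0ℚ
  peak (suc k) = if does (peak k <? d (cls k)) then d (cls k) else peak k

  mutual
    error : ℕ → ℚ
    error zero    = 0ℚ
    error (suc k) = error k + d (cls k) * (y k - pick k)

    balance : ℕ → ℕ → ℚ
    balance zero    t = 0ℚ
    balance (suc k) t =
      if does (t ℕ.≟ cls k) then balance k (cls k) + (y k - pick k) else balance k t

    pick : ℕ → ℚ
    pick k =
      -- The threshold is taken at `suc k`, so it already accounts for the demand of the class of
      -- `k`; the lower bound after an overflow pick depends on this.
      if does (½ * peak (suc k) <? error k + d (cls k) * y k) then 1ℚ
      else if does (balance k (cls k) + y k <? 1ℚ) then 0ℚ
      else 1ℚ

  -- Each constructor keeps the inequalities that its case of `step` consumes.
  data Pick (k : ℕ) : Set where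
    overflow : pick k ≡ 1ℚ → ½ * peak (suc k) < error k + d (cls k) * y k → Pick k
    complete : pick k ≡ 1ℚ → 1ℚ ≤ balance k (cls k) + y k → Pick k
    pass     : pick k ≡ 0ℚ → error k + d (cls k) * y k ≤ ½ * peak (suc k) →
               balance k (cls k) + y k < 1ℚ → Pick k

  pick-view : ∀ k → Pick k
  -- Passing the decisions as arguments lets a match on them reduce the conditionals in the type of
  -- the equation.
  pick-view k = view (_ <? _) (_ <? _) refl
    where
    view : (over? : Dec (½ * peak (suc k) < error k + d (cls k) * y k))
           (more? : Dec (balance k (cls k) + y k < 1ℚ)) →
           pick k ≡ (if does over? then 1ℚ else if does more? then 0ℚ else 1ℚ) → Pick k
    view (yes over) _         pick≡ = overflow pick≡ over
    view (no ¬over) (yes <1) pick≡ = pass pick≡ (≮⇒≥ ¬over) <1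
    view (no _)     (no ≮1)  pick≡ = complete pick≡ (≮⇒≥ ≮1)

  pick-01 : ∀ k → pick k ≡ 0ℚ ⊎ pick k ≡ 1ℚ
  pick-01 k with pick-view k
  ... | overflow z≡1 _ = inj₂ z≡1
  ... | complete z≡1 _ = inj₂ z≡1
  ... | pass z≡0 _ _   = inj₁ z≡0

  -- Prefix sums of a single class

  restrict : (ℕ → ℚ) → ℕ → ℕ → ℚ
  restrict q t j = if does (t ℕ.≟ cls j) then q j else 0ℚ

  part : (ℕ → ℚ) → ℕ → ℕ → ℚ
  part q t = Σ< (restrict q t)

  restrict-off : ∀ q {t j} → t ≢ cls j → restrict q t j ≡ 0ℚ
  restrict-off q {t} {j} = if-no (t ℕ.≟ cls j)

  part-here : ∀ q k → part q (cls k) (suc k) ≡ part q (cls k) k + q k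
  part-here q k = cong (part q (cls k) k +_) (if-yes (cls k ℕ.≟ cls k) refl)

  part-elsewhere : ∀ q {t k} → t ≢ cls k → part q t (suc k) ≡ part q t k
  part-elsewhere q {t} {k} t≢ =
    trans (cong (part q t k +_) (restrict-off q t≢)) (+-identityʳ _)

  balance-here : ∀ k → balance (suc k) (cls k) ≡ balance k (cls k) + (y k - pick k)
  balance-here k = if-yes (cls k ℕ.≟ cls k) refl

  balance-elsewhere : ∀ {t k} → t ≢ cls k → balance (suc k) t ≡ balance k t
  balance-elsewhere {t} {k} = if-no (t ℕ.≟ cls k)

  -- The recursive `balance` suits constant-time updates; the difference of prefix sums lets mass
  -- and picks of a class be bounded separately.
  balance-split : ∀ k t → balance k t ≡ part y t k - part pick t k
  balance-split zero    t = refl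
  balance-split (suc k) t with t ℕ.≟ cls k
  ... | yes refl = begin
    balance (suc k) t                            ≡⟨ balance-here k ⟩
    balance k t + (y k - pick k)                 ≡⟨ cong (_+ (y k - pick k)) (balance-split k t) ⟩
    part y t k - part pick t k + (y k - pick k)  ≡⟨ solve 4 (λ p c a b → p :- c :+ (a :- b) := p :+ a :- (c :+ b)) refl
                                                      (part y t k) (part pick t k) (y k) (pick k) ⟩
    part y t k + y k - (part pick t k + pick k)  ≡⟨ cong₂ _-_ (part-here y k) (part-here pick k) ⟨
    part y t (suc k) - part pick t (suc k)       ∎
    where open ≡-Reasoning
  ... | no t≢s = begin
    balance (suc k) t                        ≡⟨ balance-elsewhere {t} {k} t≢s ⟩
    balance k t                              ≡⟨ balance-split k t ⟩
    part y t k - part pick t k               ≡⟨ cong₂ _-_ (part-elsewhere y t≢s) (part-elsewhere pick t≢s) ⟨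
    part y t (suc k) - part pick t (suc k)   ∎
    where open ≡-Reasoning

  -- Both prefix sums only gain zeros. With `m` equal to 0, a class not yet met has balance 0.
  balance-extend : ∀ {t m n} → m ℕ.≤ n → (∀ j → m ℕ.≤ j → j ℕ.< n → t ≢ cls j) →
                   balance n t ≡ balance m t
  balance-extend {t} {m} {n} m≤n absent = begin
    balance n t                  ≡⟨ balance-split n t ⟩
    part y t n - part pick t n   ≡⟨ cong₂ _-_ (part-extend y) (part-extend pick) ⟩
    part y t m - part pick t m   ≡⟨ balance-split m t ⟨
    balance m t                  ∎
    where
    open ≡-Reasoning
    part-extend : ∀ q → part q t n ≡ part q t m
    part-extend q = Σ<-extend m≤n (λ j m≤j j<n → restrict-off q (absent j m≤j j<n))

  -- The largest demand so far, and first elements of classes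

  peak-step : ∀ k → peak k ≤ peak (suc k)
  peak-step k = proj₁ (larger-upper (peak k <? d (cls k)))

  d≤peak : ∀ k → d (cls k) ≤ peak (suc k)
  d≤peak k = proj₂ (larger-upper (peak k <? d (cls k)))

  peak-mono : ∀ {m n} → m ℕ.≤ n → peak m ≤ peak n
  peak-mono = go ∘ ℕ.≤⇒≤′
    where
    go : ∀ {m n} → m ℕ.≤′ n → peak m ≤ peak n
    go ℕ.≤′-refl             = ≤-refl
    go (ℕ.≤′-step {n = n} p) = ≤-trans (go p) (peak-step n)

  peak-lub : ∀ {M} → 0ℚ ≤ M → (∀ t → d t ≤ M) → ∀ k → peak k ≤ M
  peak-lub 0≤M d≤M zero    = 0≤M
  peak-lub 0≤M d≤M (suc k) =
    if-both (_≤ _) (does (peak k <? d (cls k))) (d≤M (cls k)) (peak-lub 0≤M d≤M k)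

  first : ∀ k → ∃[ f ] f ℕ.≤ k × cls f ≡ cls k × (∀ j → j ℕ.< f → cls k ≢ cls j)
  first k = go k k ℕ.≤-refl refl (λ j k≤j j<k → contradiction j<k (ℕ.≤⇒≯ k≤j))
    where
    -- Downward search: `f` is the earliest element of the class found so far, and the positions
    -- from `n` up to but excluding `f` are known to avoid the class.
    go : ∀ f n → f ℕ.≤ k → cls f ≡ cls k →
         (∀ j → n ℕ.≤ j → j ℕ.< f → cls k ≢ cls j) →
         ∃[ f ] f ℕ.≤ k × cls f ≡ cls k × (∀ j → j ℕ.< f → cls k ≢ cls j)
    go f zero    f≤k f∈ none = f , f≤k , f∈ , λ j → none j ℕ.z≤n
    go f (suc n) f≤k f∈ none with n ℕ.<? f | cls k ℕ.≟ cls n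
    ... | no n≮f  | _       = go f n f≤k f∈ λ j n≤j j<f → contradiction (ℕ.≤-<-trans n≤j j<f) n≮f
    ... | yes n<f | yes n∈  = go n n (ℕ.≤-trans (ℕ.<⇒≤ n<f) f≤k) (sym n∈)
                                λ j n≤j j<n → contradiction j<n (ℕ.≤⇒≯ n≤j)
    ... | yes n<f | no n∉   = go f n f≤k f∈ λ j n≤j j<f → case ℕ.m≤n⇒m<n∨m≡n n≤j of λ where
      (inj₁ n<j)  → none j n<j j<f
      (inj₂ refl) → n∉

  -- The invariant of the scan

  module Analysis
    (ℓ N : ℕ)
    (cls<N : ∀ {k} → k ℕ.< ℓ → cls k ℕ.< N)
    (non-crossing : ∀ {a b c e} → a ℕ.< b → b ℕ.< c → c ℕ.< e → e ℕ.< ℓ →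
                    cls a ≡ cls c → cls b ≡ cls e → cls a ≡ cls b)
    (0≤d : ∀ t → 0ℚ ≤ d t)
    (0≤y : ∀ k → 0ℚ ≤ y k)
    (y≤1 : ∀ k → y k ≤ 1ℚ)
    (total : ∀ {t} → t ℕ.< N → part y t ℓ ≡ 1ℚ)
    where

    -- Element `k` changes only the balance of its own class, by `w`, so the sum moves by `d s * w`,
    -- just as `error` does.
    error-balance : ∀ k → k ℕ.≤ ℓ → error k ≡ Σ< (λ t → d t * balance k t) N
    error-balance zero _ = sym (Σ<-extend (ℕ.z≤n {N}) (λ t _ _ → *-zeroʳ (d t)))
    error-balance (suc k) k<ℓ = begin
      error k + d s * w
        ≡⟨ cong (_+ d s * w) (error-balance k (ℕ.<⇒≤ k<ℓ)) ⟩
      Σ< (λ t → d t * balance k t) N + d s * w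
        ≡⟨ cong (Σ< (λ t → d t * balance k t) N +_)
             (trans (solve 3 (λ a b c → a :* c := a :* (b :+ c) :- a :* b) refl (d s) (balance k s) w)
                    (cong (λ b → d s * b - d s * balance k s) (sym (balance-here k)))) ⟩
      Σ< (λ t → d t * balance k t) N + (d s * balance (suc k) s - d s * balance k s)
        ≡⟨ Σ<-update N (cls<N k<ℓ) (λ t t≢s → cong (d t *_) (balance-elsewhere {t} {k} t≢s)) ⟨
      Σ< (λ t → d t * balance (suc k) t) N ∎
      where
      open ≡-Reasoning
      s = cls k
      w = y k - pick k

    -- The first two fields yield the discrepancy bound. The last two yield integrality: no class is
    -- picked twice, and none exhausts its mass unpicked.
    record Invariant (k : ℕ) : Set where
      field
        lower     : - (½ * peak k) ≤ error k
        upper     : error k ≤ ½ * peak k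
        picks     : ∀ t → part pick t k ≡ 0ℚ ⊎ part pick t k ≡ 1ℚ
        balance<1 : ∀ t → balance k t < 1ℚ

    open Invariant

    0≤restrict : ∀ t j → 0ℚ ≤ restrict y t j
    0≤restrict t j = if-both (0ℚ ≤_) (does (t ℕ.≟ cls j)) (0≤y j) ≤-refl

    part≤1 : ∀ {t k} → t ℕ.< N → k ℕ.≤ ℓ → part y t k ≤ 1ℚ
    part≤1 {t} t<N k≤ℓ = ≤-trans (Σ<-mono (0≤restrict t) k≤ℓ) (≤-reflexive (total t<N))

    -- Without a pick the balance would be 1, against `balance<1`.
    picked : ∀ {k} t → Invariant k → part y t k ≡ 1ℚ → part pick t k ≡ 1ℚ
    picked {k} t inv y≡1 with picks inv t
    ... | inj₂ c≡1 = c≡1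
    ... | inj₁ c≡0 = contradiction
      (trans (balance-split k t) (cong₂ _-_ y≡1 c≡0)) (<⇒≢ (balance<1 inv t))

    -- With no element left to come, the class has shown its whole mass 1, which its single pick
    -- cancels.
    balance-complete : ∀ {k t} → Invariant k → k ℕ.≤ ℓ → t ℕ.< N →
                       (∀ j → k ℕ.≤ j → j ℕ.< ℓ → t ≢ cls j) → balance k t ≡ 0ℚ
    balance-complete {k} {t} inv k≤ℓ t<N absent =
      trans (balance-split k t) (cong₂ _-_ y≡1 (picked t inv y≡1))
      where
      y≡1 : part y t k ≡ 1ℚ
      y≡1 = trans (sym (Σ<-extend k≤ℓ (λ j k≤j j<ℓ → restrict-off y (absent j k≤j j<ℓ)))) (total t<N)

    -- An element `j` to the left would give the crossing `j, f, g, k`, one to the right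
    -- `f, g, k, j`; and `j` is neither `f` nor `k`, whose class differs.
    nested : ∀ {f g k j} → f ℕ.< g → g ℕ.< k → k ℕ.< ℓ → j ℕ.< ℓ →
             cls f ≡ cls k → cls g ≢ cls k → cls g ≡ cls j → f ℕ.< j × j ℕ.< k
    nested {f} {g} {k} {j} f<g g<k k<ℓ j<ℓ f~k g≁k g~j with ℕ.<-cmp j f | ℕ.<-cmp j k
    ... | tri< j<f _ _ | _ = contradiction
      (trans g~j (trans (non-crossing j<f f<g g<k k<ℓ (sym g~j) f~k) f~k)) g≁k
    ... | tri≈ _ refl _ | _ = contradiction (trans g~j f~k) g≁k
    ... | tri> _ _ f<j | tri< j<k _ _ = f<j , j<k
    ... | tri> _ _ _ | tri≈ _ refl _ = contradiction g~j g≁k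
    ... | tri> _ _ _ | tri> _ _ k<j = contradiction
      (trans (sym (non-crossing f<g g<k k<j j<ℓ f~k g~j)) f~k) g≁k

    -- Between the first element f of its class and k, every other class either
    -- has no element or lies entirely inside, and then it contributes nothing.
    error-from-first : ∀ {f k} → Invariant k → k ℕ.< ℓ → f ℕ.≤ k → cls f ≡ cls k →
                       (∀ j → j ℕ.< f → cls k ≢ cls j) →
                       error k ≡ error f + d (cls k) * balance k (cls k)
    error-from-first {f} {k} inv k<ℓ f≤k f~k none = begin
      error k
        ≡⟨ error-balance k (ℕ.<⇒≤ k<ℓ) ⟩
      Σ< (λ t → d t * balance k t) N
        ≡⟨ Σ<-update N (cls<N k<ℓ) (λ t t≢s → cong (d t *_) (same t t≢s)) ⟩
      Σ< (λ t → d t * balance f t) N + (d s * balance k s - d s * balance f s)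
        ≡⟨ cong₂ (λ e b → e + (d s * balance k s - d s * b))
             (sym (error-balance f (ℕ.≤-trans f≤k (ℕ.<⇒≤ k<ℓ))))
             (balance-extend ℕ.z≤n (λ j _ → none j)) ⟩
      error f + (d s * balance k s - d s * 0ℚ)
        ≡⟨ solve 3 (λ e a b → e :+ (a :* b :- a :* con 0ℚ) := e :+ a :* b) refl
             (error f) (d s) (balance k s) ⟩
      error f + d s * balance k s ∎
      where
      open ≡-Reasoning
      s = cls k
      same : ∀ t → t ≢ s → balance k t ≡ balance f t
      -- The case split is whether class `t` has an element strictly between `f` and `k`. If it has,
      -- the balance is 0 at both ends: complete at `k`, not yet begun at `f`.
      same t t≢s with anyUpTo? (λ j → f ℕ.<? j ×-dec t ℕ.≟ cls j) k
      ... | no ¬inside = balance-extend f≤k absent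
        where
        absent : ∀ j → f ℕ.≤ j → j ℕ.< k → t ≢ cls j
        absent j f≤j j<k t≡ with ℕ.m≤n⇒m<n∨m≡n f≤j
        ... | inj₁ f<j  = ¬inside (j , j<k , f<j , t≡)
        ... | inj₂ refl = t≢s (trans t≡ f~k)
      ... | yes (g , g<k , f<g , refl) = trans
        (balance-complete inv (ℕ.<⇒≤ k<ℓ) (cls<N (ℕ.<-trans g<k k<ℓ)) after)
        (sym (balance-extend ℕ.z≤n before))
        where
        after : ∀ j → k ℕ.≤ j → j ℕ.< ℓ → cls g ≢ cls j
        after j k≤j j<ℓ g~j with nested f<g g<k k<ℓ j<ℓ f~k t≢s g~j
        ... | _ , j<k = ℕ.≤⇒≯ k≤j j<k
        before : ∀ j → 0 ℕ.≤ j → j ℕ.< f → cls g ≢ cls j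
        before j _ j<f g~j
          with nested f<g g<k k<ℓ (ℕ.<-trans j<f (ℕ.≤-<-trans f≤k k<ℓ)) f~k t≢s g~j
        ... | f<j , _ = ℕ.<-asym f<j j<f

    half-peak-mono : ∀ {m n} → m ℕ.≤ n → ½ * peak m ≤ ½ * peak n
    half-peak-mono m≤n = *-monoˡ-≤-nonNeg ½ (peak-mono m≤n)

    -- Strong induction, because the bounds at `k` refer back to those at the first element `f` of
    -- its class.
    step : ∀ {k} → k ℕ.< ℓ → (∀ j → j ℕ.≤ k → Invariant j) → Invariant (suc k)
    step {k} k<ℓ earlier with first k
    ... | f , f≤k , f~k , none = go (pick-view k)
      where
      s = cls k
      b = balance k s
      inv = earlier k ℕ.≤-refl
      k≤1+k = ℕ.n≤1+n k
      f≤1+k = ℕ.≤-trans f≤k k≤1+k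

      -- Refers the error with `y k` added and no pick yet subtracted to `error f`; it serves both
      -- to exclude a second overflow and to bound a completing pick.
      error-after : error k + d s * y k ≡ error f + d s * (b + y k)
      error-after = trans
        (cong (_+ d s * y k) (error-from-first inv k<ℓ f≤k f~k none))
        (solve 4 (λ e a b c → e :+ a :* b :+ a :* c := e :+ a :* (b :+ c)) refl (error f) (d s) b (y k))

      mass≤1 : part y s k + y k ≤ 1ℚ
      mass≤1 = subst (_≤ 1ℚ) (part-here y k) (part≤1 (cls<N k<ℓ) k<ℓ)

      b+y≡ : ∀ {c} → part pick s k ≡ c → b + y k ≡ part y s k + y k - c
      b+y≡ {c} c≡ = trans
        (cong (_+ y k) (trans (balance-split k s) (cong (λ z → part y s k - z) c≡)))
        (solve 3 (λ p c a → p :- c :+ a := p :+ a :- c) refl (part y s k) c (y k))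

      fresh-mass≤1 : part pick s k ≡ 0ℚ → b + y k ≤ 1ℚ
      fresh-mass≤1 c≡0 = ≤-trans
        (≤-reflexive (trans (b+y≡ c≡0) (+-identityʳ _))) mass≤1

      -- The earlier pick cancels a unit, and the class holds at most one unit of mass.
      picked-mass≤0 : part pick s k ≡ 1ℚ → b + y k ≤ 0ℚ
      picked-mass≤0 c≡1 = ≤-trans (≤-reflexive (b+y≡ c≡1)) (≤⇒-≤0 mass≤1)

      -- After the pick, the error is at most its value just before f.
      no-overflow : part pick s k ≡ 1ℚ → error k + d s * y k ≤ ½ * peak (suc k)
      no-overflow c≡1 = begin
        error k + d s * y k         ≡⟨ error-after ⟩
        error f + d s * (b + y k)   ≤⟨ +-monoʳ-≤ (error f) (*-mono-≤-nonNeg (0≤d s) (picked-mass≤0 c≡1)) ⟩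
        error f + d s * 0ℚ          ≡⟨ solve 2 (λ e a → e :+ a :* con 0ℚ := e) refl (error f) (d s) ⟩
        error f                     ≤⟨ upper (earlier f f≤k) ⟩
        ½ * peak f                  ≤⟨ half-peak-mono f≤1+k ⟩
        ½ * peak (suc k)            ∎
        where open ≤-Reasoning

      lower-mono : ∀ {m e} → m ℕ.≤ suc k → - (½ * peak m) ≤ e → - (½ * peak (suc k)) ≤ e
      lower-mono m≤ = ≤-trans (neg-antimono-≤ (half-peak-mono m≤))

      error-with : ∀ {z} → pick k ≡ z → error (suc k) ≡ error k + d s * (y k - z)
      error-with z≡ = cong (λ z → error k + d s * (y k - z)) z≡

      picks-here : ∀ {c z} → part pick s k ≡ c → pick k ≡ z → part pick s (suc k) ≡ c + z
      picks-here c≡ z≡ = trans (part-here pick k) (cong₂ _+_ c≡ z≡)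

      balance-with : ∀ {z} → pick k ≡ z → balance (suc k) s ≡ b + y k - z
      balance-with z≡ = trans (balance-here k) (trans (cong (λ z → b + (y k - z)) z≡)
        (sym (+-assoc b (y k) _)))

      everywhere : ∀ {P : ℕ → Set} → P s → (∀ t → t ≢ s → P t) → ∀ t → P t
      everywhere Ps P≢s t with t ℕ.≟ s
      ... | yes refl = Ps
      ... | no t≢s   = P≢s t t≢s

      assemble : - (½ * peak (suc k)) ≤ error (suc k) → error (suc k) ≤ ½ * peak (suc k) →
                 part pick s (suc k) ≡ 0ℚ ⊎ part pick s (suc k) ≡ 1ℚ →
                 balance (suc k) s < 1ℚ → Invariant (suc k)
      assemble lo up c b<1 = record
        { lower     = lo
        ; upper     = up
        ; picks     = everywhere c λ t t≢s →
            subst (λ p → p ≡ 0ℚ ⊎ p ≡ 1ℚ) (sym (part-elsewhere pick t≢s)) (picks inv t)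
        ; balance<1 = everywhere b<1 λ t t≢s →
            subst (_< 1ℚ) (sym (balance-elsewhere {t} {k} t≢s)) (balance<1 inv t)
        }

      0<1 : 0ℚ < 1ℚ
      0<1 = positive⁻¹ 1ℚ

      -- Common to both kinds of pick: since `y k` is at most 1, a pick never raises the error, so
      -- only the lower bound has to be argued by kind.
      assemble-picked : pick k ≡ 1ℚ → part pick s k ≡ 0ℚ →
                        - (½ * peak (suc k)) ≤ error (suc k) → Invariant (suc k)
      assemble-picked z≡1 c≡0 lo = assemble lo up (inj₂ (picks-here c≡0 z≡1)) b<1
        where
        open ≤-Reasoning
        up : error (suc k) ≤ ½ * peak (suc k)
        up = begin
          error (suc k)                ≡⟨ error-with z≡1 ⟩
          error k + d s * (y k - 1ℚ)   ≤⟨ +-monoʳ-≤ (error k) (*-mono-≤-nonNeg (0≤d s) (≤⇒-≤0 (y≤1 k))) ⟩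
          error k + d s * 0ℚ           ≡⟨ solve 2 (λ e a → e :+ a :* con 0ℚ := e) refl (error k) (d s) ⟩
          error k                      ≤⟨ upper inv ⟩
          ½ * peak k                   ≤⟨ half-peak-mono k≤1+k ⟩
          ½ * peak (suc k)             ∎
        b<1 : balance (suc k) s < 1ℚ
        b<1 = begin-strict
          balance (suc k) s   ≡⟨ balance-with z≡1 ⟩
          b + y k - 1ℚ        ≤⟨ ≤⇒-≤0 (fresh-mass≤1 c≡0) ⟩
          0ℚ                  <⟨ 0<1 ⟩
          1ℚ                  ∎

      go : Pick k → Invariant (suc k)
      go (overflow z≡1 over) with picks inv s
      ... | inj₂ c≡1 = contradiction (<-≤-trans over (no-overflow c≡1)) (<-irrefl refl)
      ... | inj₁ c≡0 = assemble-picked z≡1 c≡0 (begin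
        -- The test puts the error above `H`, half the peak, and the pick then subtracts `d s`, at
        -- most the whole peak.
        - H                           ≡⟨ solve 1 (λ p → :- (con ½ :* p) := con ½ :* p :- p) refl (peak (suc k)) ⟩
        H - peak (suc k)              ≤⟨ +-mono-≤ (<⇒≤ over) (neg-antimono-≤ (d≤peak k)) ⟩
        error k + d s * y k - d s     ≡⟨ solve 3 (λ e a c → e :+ a :* c :- a := e :+ a :* (c :- con 1ℚ)) refl (error k) (d s) (y k) ⟩
        error k + d s * (y k - 1ℚ)    ≡⟨ error-with z≡1 ⟨
        error (suc k)                 ∎)
        where
        open ≤-Reasoning
        H = ½ * peak (suc k)
      go (complete z≡1 1≤b+y) with picks inv s
      ... | inj₂ c≡1 = contradiction (<-≤-trans 0<1 (≤-trans 1≤b+y (picked-mass≤0 c≡1))) (<-irrefl refl)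
      ... | inj₁ c≡0 = assemble-picked z≡1 c≡0 (lower-mono f≤1+k (begin
        -- Since `f` the class has accumulated at least `d s`, which pays for the pick, so the error
        -- stays at or above `error f`.
        - (½ * peak f)                ≤⟨ lower (earlier f f≤k) ⟩
        error f                       ≡⟨ solve 2 (λ e a → e := e :+ a :* con 1ℚ :- a) refl (error f) (d s) ⟩
        error f + d s * 1ℚ - d s      ≤⟨ +-monoˡ-≤ (- d s) (+-monoʳ-≤ (error f) (*-mono-≤-nonNeg (0≤d s) 1≤b+y)) ⟩
        error f + d s * (b + y k) - d s ≡⟨ cong (_- d s) error-after ⟨
        error k + d s * y k - d s     ≡⟨ solve 3 (λ e a c → e :+ a :* c :- a := e :+ a :* (c :- con 1ℚ)) refl (error k) (d s) (y k) ⟩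
        error k + d s * (y k - 1ℚ)    ≡⟨ error-with z≡1 ⟨
        error (suc k)                 ∎))
        where open ≤-Reasoning
      go (pass z≡0 fits b+y<1) = assemble
        (lower-mono k≤1+k (begin
          - (½ * peak k)        ≤⟨ lower inv ⟩
          error k               ≡⟨ solve 2 (λ e a → e := e :+ a :* con 0ℚ) refl (error k) (d s) ⟩
          error k + d s * 0ℚ    ≤⟨ +-monoʳ-≤ (error k) (*-mono-≤-nonNeg (0≤d s) (0≤y k)) ⟩
          error k + d s * y k   ≡⟨ error≡ ⟨
          error (suc k)         ∎))
        -- The failed overflow test is itself the upper bound.
        (≤-trans (≤-reflexive error≡) fits)
        (subst (λ p → p ≡ 0ℚ ⊎ p ≡ 1ℚ)
           (sym (trans (picks-here refl z≡0) (+-identityʳ _))) (picks inv s))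
        (subst (_< 1ℚ) (sym (trans (balance-with z≡0) (+-identityʳ _))) b+y<1)
        where
        open ≤-Reasoning
        error≡ : error (suc k) ≡ error k + d s * y k
        error≡ = trans (error-with z≡0) (cong (λ w → error k + d s * w) (+-identityʳ (y k)))

    initial : Invariant 0
    initial = record
      { lower = ≤-refl ; upper = ≤-refl ; picks = λ _ → inj₁ refl ; balance<1 = λ _ → positive⁻¹ 1ℚ }

    invariants : ∀ k → k ℕ.≤ ℓ → ∀ j → j ℕ.≤ k → Invariant j
    invariants zero    _   zero ℕ.z≤n = initial
    invariants (suc k) k<ℓ j    j≤1+k with ℕ.m≤n⇒m<n∨m≡n j≤1+k
    ... | inj₁ j<1+k = invariants k (ℕ.<⇒≤ k<ℓ) j (s≤s⁻¹ j<1+k)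
    ... | inj₂ refl  = step k<ℓ (invariants k (ℕ.<⇒≤ k<ℓ))

    invariant : ∀ {k} → k ℕ.≤ ℓ → Invariant k
    invariant k≤ℓ = invariants _ k≤ℓ _ ℕ.≤-refl

    pick-total : ∀ {t} → t ℕ.< N → part pick t ℓ ≡ 1ℚ
    pick-total {t} t<N = picked t (invariant ℕ.≤-refl) (total t<N)

    error-bound : ∀ {k} → k ℕ.≤ ℓ → ∣ error k ∣ ≤ ½ * peak k
    error-bound {k} k≤ℓ with ∣p∣≡p∨∣p∣≡-p (error k)
    ... | inj₁ ≡+ = ≤-trans (≤-reflexive ≡+) (upper (invariant k≤ℓ))
    ... | inj₂ ≡- = ≤-trans (≤-reflexive ≡-)
      (subst (- error k ≤_) (solve 1 (λ p → :- (:- p) := p) refl (½ * peak k)) (neg-antimono-≤ (lower (invariant k≤ℓ))))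

  weighted : (ℕ → ℚ) → ℕ → ℚ
  weighted q j = d (cls j) * q j

  -- Identifies `error` with the signed quantity whose absolute value is `D` on a prefix.
  error-difference : ∀ k → error k ≡ Σ< (weighted y) k - Σ< (weighted pick) k
  error-difference zero    = refl
  error-difference (suc k) = trans (cong (_+ d (cls k) * (y k - pick k)) (error-difference k))
    (solve 5 (λ u v a b c → u :- v :+ a :* (b :- c) := u :+ a :* b :- (v :+ a :* c)) refl
       (Σ< (weighted y) k) (Σ< (weighted pick) k) (d (cls k)) (y k) (pick k))

-- Cost of loop-free programs and counting loops

LoopFree : Program → Set
LoopFree skip           = ⊤
LoopFree (setNat _ _ _) = ⊤
LoopFree (setRat _ _ _) = ⊤
LoopFree (P ⨾ Q)        = LoopFree P × LoopFree Q
LoopFree (if _ P Q)     = LoopFree P × LoopFree Q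
LoopFree (while _ _)    = ⊥

-- The value on loops is junk.
run : Program → Store → Store
run skip           σ = σ
run (setNat a i e) σ = store (nat σ [ a , evalℕ i σ ]≔ evalℕ e σ) (rat σ)
run (setRat a i e) σ = store (nat σ) (rat σ [ a , evalℕ i σ ]≔ evalℚ e σ)
run (P ⨾ Q)        σ = run Q (run P σ)
run (if b P Q)     σ = if evalTest b σ then run P σ else run Q σ
run (while _ _)    σ = σ

-- Adding the two branches of `if` bounds the larger one, at the price of a constant factor only.
bound : Program → ℕ
bound skip           = 1
bound (setNat _ i e) = suc (costℕ i ℕ.+ costℕ e)
bound (setRat _ i e) = suc (costℕ i ℕ.+ costℚ e)
bound (P ⨾ Q)        = suc (bound P ℕ.+ bound Q)
bound (if b P Q)     = suc (costTest b ℕ.+ (bound P ℕ.+ bound Q))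
bound (while _ _)    = 0

run-correct : ∀ P → LoopFree P → ∀ σ → ∃[ t ] (P ∶ σ ⇓ run P σ ∶ t) × t ℕ.≤ bound P
run-correct skip           _ σ = _ , ⇓skip , ℕ.≤-refl
run-correct (setNat _ _ _) _ σ = _ , ⇓setNat , ℕ.≤-refl
run-correct (setRat _ _ _) _ σ = _ , ⇓setRat , ℕ.≤-refl
run-correct (P ⨾ Q) (lp , lq) σ
  with run-correct P lp σ | run-correct Q lq (run P σ)
... | _ , p , s≤ | _ , q , t≤ = _ , ⇓seq p q , s≤s (ℕ.+-mono-≤ s≤ t≤)
run-correct (if b P Q) (lp , lq) σ with evalTest b σ in eq
... | true  with run-correct P lp σ
...   | _ , p , t≤ = _ , ⇓ifTrue eq p ,
          s≤s (ℕ.+-monoʳ-≤ (costTest b) (ℕ.m≤n⇒m≤n+o (bound Q) t≤))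
run-correct (if b P Q) (lp , lq) σ | false with run-correct Q lq σ
...   | _ , q , t≤ = _ , ⇓ifFalse eq q ,
          s≤s (ℕ.+-monoʳ-≤ (costTest b) (ℕ.m≤n⇒m≤o+n (bound P) t≤))

-- Induction on the number `m` of iterations left. The extra unit in `suc n` pays for the final,
-- failing test.
while-counting :
  ∀ {b P n} (I : ℕ → Store → Set) → LoopFree P →
  (∀ {k σ} → k ℕ.< n → I k σ → evalTest b σ ≡ true) →
  (∀ {σ} → I n σ → evalTest b σ ≡ false) →
  (∀ {k σ} → k ℕ.< n → I k σ → I (suc k) (run P σ)) →
  ∀ {σ} → I 0 σ →
  ∃₂ λ τ t → (while b P ∶ σ ⇓ τ ∶ t) × t ℕ.≤ suc (costTest b ℕ.+ bound P) *ℕ suc n × I n τ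
while-counting {b} {P} {n} I lf continues stops preserved i₀ =
  case go n (ℕ.+-identityʳ n) i₀ of λ where
    (τ , t , w , t≤ , i) → τ , t , w , ℕ.≤-trans t≤ (ℕ.≤-reflexive (ℕ.*-comm (suc n) c)) , i
  where
  c = suc (costTest b ℕ.+ bound P)
  go : ∀ m {k σ} → m ℕ.+ k ≡ n → I k σ →
       ∃₂ λ τ t → (while b P ∶ σ ⇓ τ ∶ t) × t ℕ.≤ suc m *ℕ c × I n τ
  go zero refl i =
    _ , _ , ⇓whileFalse (stops i) , s≤s (ℕ.m≤n⇒m≤n+o 0 (ℕ.m≤m+n (costTest b) (bound P))) , i
  go (suc m) {k} {σ} refl i with run-correct P lf σ | go m (ℕ.+-suc m k) (preserved k<n i)
    where
    k<n : k ℕ.< n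
    k<n = s≤s (ℕ.m≤n+m k m)
  ... | s , p , s≤ | τ , t , w , t≤ , j =
    τ , _ , ⇓whileTrue (continues (s≤s (ℕ.m≤n+m k m)) i) p w , time , j
    where
    open ℕ.≤-Reasoning
    time : suc (costTest b ℕ.+ (s ℕ.+ t)) ℕ.≤ suc (suc m) *ℕ c
    time = begin
      suc (costTest b ℕ.+ (s ℕ.+ t))   ≡⟨ cong suc (ℕ.+-assoc (costTest b) s t) ⟨
      suc (costTest b ℕ.+ s) ℕ.+ t     ≤⟨ ℕ.+-mono-≤ (s≤s (ℕ.+-monoʳ-≤ (costTest b) s≤)) t≤ ⟩
      c ℕ.+ suc m *ℕ c                 ∎

-- The program: integer cell (0 , 2) is the loop counter, rational arrays 3, 4
-- and 5 hold peak, error and balance.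

module Code where

  index class : NatExp
  index = cell 0 (lit 2)
  class = cell 1 index

  weight value picked peak error balance : RatExp
  weight  = cell 0 class
  value   = cell 1 index
  picked  = cell 2 index
  peak    = cell 3 (lit 0)
  error   = cell 4 (lit 0)
  balance = cell 5 class

  raise take choose shift-error shift-balance next body greedy : Program
  raise         = if (peak ⋖ weight) (setRat 3 (lit 0) weight) skip
  take          = setRat 2 index (lit 1ℚ)
  choose        = if (lit ½ ⊛ peak ⋖ error ⊞ weight ⊛ value) take
                    -- `skip` records a 0, because the cells of array 2 start out as 0.
                    (if (balance ⊞ value ⋖ lit 1ℚ) skip take)
  shift-error   = setRat 4 (lit 0) (error ⊞ weight ⊛ (value ⊟ picked))
  shift-balance = setRat 5 class (balance ⊞ (value ⊟ picked))
  -- With the literal on the left, the new counter reduces to `suc` of the old one.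
  next          = setNat 0 (lit 2) (lit 1 ⊕ index)
  -- `raise` comes first because the threshold includes the current demand; `next` comes last
  -- because the other steps read the counter.
  body          = raise ⨾ choose ⨾ shift-error ⨾ shift-balance ⨾ next
  greedy        = while (index ≺ cell 0 (lit 0)) body

  iteration-cost : ℕ
  iteration-cost = suc (costTest (index ≺ cell 0 (lit 0)) ℕ.+ bound body)

-- Simulation of the scan by the program

update-cong : ∀ {A : Set} j {i i′} {v v′ x x′ : A} → i ≡ i′ → v ≡ v′ → x ≡ x′ →
              (if does (j ℕ.≟ i) then v else x) ≡ (if does (j ℕ.≟ i′) then v′ else x′)
update-cong j refl refl refl = refl

module Simulation (ℓ : ℕ) (cls : ℕ → ℕ) (d y : ℕ → ℚ) where

  open Code
  module G = Greedy cls d y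

  -- n counts the decided elements; it runs ahead of the loop counter k inside the body.
  record Snapshot (n k : ℕ) (p e : ℚ) (r : ℕ → ℚ) (σ : Store) : Set where
    field
      size≡    : nat σ 0 0 ≡ ℓ
      index≡   : nat σ 0 2 ≡ k
      class≡   : ∀ j → nat σ 1 j ≡ cls j
      weight≡  : ∀ t → rat σ 0 t ≡ d t
      value≡   : ∀ j → rat σ 1 j ≡ y j
      picked≡  : ∀ j → j ℕ.< n → rat σ 2 j ≡ G.pick j
      blank    : ∀ j → n ℕ.≤ j → rat σ 2 j ≡ 0ℚ
      peak≡    : rat σ 3 0 ≡ p
      error≡   : rat σ 4 0 ≡ e
      balance≡ : ∀ t → rat σ 5 t ≡ r t

    eval-class : evalℕ class σ ≡ cls k
    eval-class = trans (class≡ _) (cong cls index≡)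

    eval-weight : evalℚ weight σ ≡ d (cls k)
    eval-weight = trans (weight≡ _) (cong d eval-class)

    eval-value : evalℚ value σ ≡ y k
    eval-value = trans (value≡ _) (cong y index≡)

    eval-balance : evalℚ balance σ ≡ r (cls k)
    eval-balance = trans (balance≡ _) (cong r eval-class)

    eval-shift : k ℕ.< n → evalℚ (value ⊟ picked) σ ≡ y k - G.pick k
    eval-shift k<n =
      cong₂ _-_ eval-value (trans (cong (rat σ 2) index≡) (picked≡ k k<n))

  open Snapshot

  -- The match is on the machine's Boolean, which `subst` then identifies with the abstract test.
  -- For `p` equal to `G.peak k` the new value is `G.peak (suc k)` by definition.
  raise-correct : ∀ {n k p e r σ} → Snapshot n k p e r σ →
    Snapshot n k (if does (p <? d (cls k)) then d (cls k) else p) e r (run raise σ)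
  raise-correct {n} {k} {p} {e} {r} {σ} S = subst (λ q → Snapshot n k q e r (run raise σ))
    (cong (if_then d (cls k) else p)
       (cong₂ (λ u v → does (u <? v)) (peak≡ S) (eval-weight S)))
    (branch (evalTest (peak ⋖ weight) σ))
    where
    branch : ∀ b → Snapshot n k (if b then d (cls k) else p) e r
                     (if b then run (setRat 3 (lit 0) weight) σ else σ)
    branch true  = record { Snapshot S hiding (peak≡) ; peak≡ = eval-weight S }
    branch false = S

  take-correct : ∀ {k p e r σ} → Snapshot k k p e r σ → G.pick k ≡ 1ℚ →
                 Snapshot (suc k) k p e r (run take σ)
  take-correct {k} {σ = σ} S z≡1 = record
    { Snapshot S hiding (picked≡; blank)
    ; picked≡ = λ j j<1+k → trans (update-cong j (index≡ S) refl refl) (new j j<1+k)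
    ; blank   = λ j k<j → trans (update-cong j (index≡ S) refl refl)
        (trans (if-no (j ℕ.≟ k) (ℕ.>⇒≢ k<j)) (blank S j (ℕ.<⇒≤ k<j)))
    }
    where
    new : ∀ j → j ℕ.< suc k → (if does (j ℕ.≟ k) then 1ℚ else rat σ 2 j) ≡ G.pick j
    new j j<1+k with ℕ.m<1+n⇒m<n∨m≡n j<1+k
    ... | inj₁ j<k  = trans (if-no (j ℕ.≟ k) (ℕ.<⇒≢ j<k)) (picked≡ S j j<k)
    ... | inj₂ refl = trans (if-yes (j ℕ.≟ j) refl) (sym z≡1)

  pass-correct : ∀ {k p e r σ} → Snapshot k k p e r σ → G.pick k ≡ 0ℚ →
                 Snapshot (suc k) k p e r σ
  pass-correct {k} {σ = σ} S z≡0 = record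
    { Snapshot S hiding (picked≡; blank)
    ; picked≡ = new
    ; blank   = λ j k<j → blank S j (ℕ.<⇒≤ k<j)
    }
    where
    new : ∀ j → j ℕ.< suc k → rat σ 2 j ≡ G.pick j
    new j j<1+k with ℕ.m<1+n⇒m<n∨m≡n j<1+k
    ... | inj₁ j<k  = picked≡ S j j<k
    ... | inj₂ refl = trans (blank S j ℕ.≤-refl) (sym z≡0)

  -- The defining conditional of `pick` is rewritten to the machine's two tests, so one match
  -- decides both.
  choose-correct : ∀ {k σ} →
    Snapshot k k (G.peak (suc k)) (G.error k) (G.balance k) σ →
    Snapshot (suc k) k (G.peak (suc k)) (G.error k) (G.balance k) (run choose σ)
  choose-correct {k} {σ} S = branch
    (evalTest (lit ½ ⊛ peak ⋖ error ⊞ weight ⊛ value) σ)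
    (evalTest (balance ⊞ value ⋖ lit 1ℚ) σ)
    (cong₂ (λ b c → if b then 1ℚ else if c then 0ℚ else 1ℚ)
       (cong₂ (λ u v → does (u <? v))
          (sym (cong (½ *_) (peak≡ S)))
          (sym (cong₂ _+_ (error≡ S) (cong₂ _*_ (eval-weight S) (eval-value S)))))
       (cong (λ u → does (u <? 1ℚ))
          (sym (cong₂ _+_ (eval-balance S) (eval-value S)))))
    where
    branch : ∀ b c → G.pick k ≡ (if b then 1ℚ else if c then 0ℚ else 1ℚ) →
             Snapshot (suc k) k (G.peak (suc k)) (G.error k) (G.balance k)
               (if b then run take σ else if c then σ else run take σ)
    branch true  _     = take-correct S
    branch false true  = pass-correct S
    branch false false = take-correct S

  shift-error-correct : ∀ {k p r σ} → Snapshot (suc k) k p (G.error k) r σ →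
                        Snapshot (suc k) k p (G.error (suc k)) r (run shift-error σ)
  shift-error-correct S = record
    { Snapshot S hiding (error≡)
    ; error≡ = cong₂ _+_ (error≡ S) (cong₂ _*_ (eval-weight S) (eval-shift S ℕ.≤-refl))
    }

  shift-balance-correct : ∀ {k p e σ} → Snapshot (suc k) k p e (G.balance k) σ →
                          Snapshot (suc k) k p e (G.balance (suc k)) (run shift-balance σ)
  shift-balance-correct S = record
    { Snapshot S hiding (balance≡)
    ; balance≡ = λ t → update-cong t (eval-class S)
        (cong₂ _+_ (eval-balance S) (eval-shift S ℕ.≤-refl)) (balance≡ S t)
    }

  next-correct : ∀ {n k p e r σ} → Snapshot n k p e r σ →
                 Snapshot n (suc k) p e r (run next σ)
  next-correct S = record { Snapshot S hiding (index≡) ; index≡ = cong suc (index≡ S) }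

  Progress : ℕ → Store → Set
  Progress k = Snapshot k k (G.peak k) (G.error k) (G.balance k)

  body-correct : ∀ {k σ} → Progress k σ → Progress (suc k) (run body σ)
  body-correct = next-correct ∘ shift-balance-correct ∘ shift-error-correct ∘ choose-correct ∘ raise-correct

  greedy-correct : ∀ {σ} → Progress 0 σ →
    ∃₂ λ τ t → (greedy ∶ σ ⇓ τ ∶ t)
             × t ℕ.≤ iteration-cost *ℕ suc ℓ
             × Progress ℓ τ
  greedy-correct = while-counting Progress _
    (λ k<ℓ S → trans (test≡ S) (dec-true (_ ℕ.<? ℓ) k<ℓ))
    (λ S → trans (test≡ S) (dec-false (ℓ ℕ.<? ℓ) (ℕ.<-irrefl refl)))
    (λ _ → body-correct)
    where
    test≡ : ∀ {k σ} → Progress k σ →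
            evalTest (index ≺ cell 0 (lit 0)) σ ≡ does (k ℕ.<? ℓ)
    test≡ S = cong₂ (λ i n → does (i ℕ.<? n)) (index≡ S) (size≡ S)

-- From Fin-indexed instances to ℕ-indexed sequences

toArray-toℕ : ∀ {A : Set} {n} {x : A} {v : Vector A n} i → toArray x v (toℕ i) ≡ v i
toArray-toℕ {n = n} {v = v} i with toℕ i ℕ.<? n
... | yes i<n = cong v (fromℕ<-toℕ i i<n)
... | no ≮    = contradiction (toℕ<n i) ≮

toArray-all : ∀ {A : Set} {n} {x : A} {v : Vector A n} (P : A → Set) →
              P x → (∀ i → P (v i)) → ∀ k → P (toArray x v k)
toArray-all {n = n} P px pv k with k ℕ.<? n
... | yes k<n = pv (fromℕ< k<n)
... | no _    = px

-- `sum` recurses on the first summand and `Σ<` on the last; `sum-init-last` reconciles them.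
sum-toℕ : ∀ {n} (g : Vector ℚ n) (h : ℕ → ℚ) → (∀ i → g i ≡ h (toℕ i)) →
          sum g ≡ Σ< h n
sum-toℕ {zero}  g h g≗h = refl
sum-toℕ {suc n} g h g≗h = trans (sum-init-last g) (cong₂ _+_
  (sum-toℕ (g ∘ inject₁) h (λ i → trans (g≗h (inject₁ i)) (cong h (toℕ-inject₁ i))))
  (trans (g≗h (fromℕ n)) (cong h (toℕ-fromℕ n))))

0≤max : ∀ {n} (v : Vector ℚ n) → 0ℚ ≤ foldr _⊔_ 0ℚ v
0≤max {zero}  v = ≤-refl
0≤max {suc n} v = ≤-trans (0≤max (v ∘ suc)) (p≤q⊔p (v zero) _)

≤max : ∀ {n} (v : Vector ℚ n) i → v i ≤ foldr _⊔_ 0ℚ v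
≤max v zero    = p≤p⊔q (v zero) _
≤max v (suc i) = ≤-trans (≤max (v ∘ suc) i) (p≤q⊔p (v zero) _)

-- The scan on a given instance

module Instance (W : WPCS) (non-interleaving : NonInterleaving (WPCS.𝒮 W)) where
  open WPCS W

  cls : ℕ → ℕ
  cls = toArray 0 (λ i → toℕ (memberOf i))

  weights values : ℕ → ℚ
  weights = toArray 0ℚ d
  values  = toArray 0ℚ y

  open Greedy cls weights values
  open Simulation ℓ cls weights values using (Snapshot; greedy-correct)

  cls-fromℕ< : ∀ {k} (k<ℓ : k ℕ.< ℓ) → cls k ≡ toℕ (memberOf (fromℕ< k<ℓ))
  cls-fromℕ< k<ℓ = trans (cong cls (sym (toℕ-fromℕ< k<ℓ))) (toArray-toℕ (fromℕ< k<ℓ))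

  cls<size : ∀ {k} → k ℕ.< ℓ → cls k ℕ.< size
  cls<size k<ℓ = subst (ℕ._< size) (sym (cls-fromℕ< k<ℓ)) (toℕ<n _)

  -- By disjointness the label chosen by `covering` is the only member containing `i`, so membership
  -- is equality of labels.
  lookup-member : ∀ s i → Vec.lookup (member s) i ≡ does (toℕ s ℕ.≟ cls (toℕ i))
  lookup-member s i with Vec.lookup (member s) i in eq
  ... | true  = sym (dec-true (toℕ s ℕ.≟ cls (toℕ i))
    (trans (cong toℕ (disjoint s (memberOf i) i (lookup⇒[]= i _ eq) (proj₂ (covering i))))
           (sym (toArray-toℕ i))))
  ... | false = sym (dec-false (toℕ s ℕ.≟ cls (toℕ i)) λ s≡ →
    case trans (sym eq) ([]=⇒lookup (subst (λ t → i ∈ member t)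
           (sym (toℕ-injective (trans s≡ (toArray-toℕ i)))) (proj₂ (covering i)))) of λ ())

  sum-member : ∀ {q : Vector ℚ ℓ} {q′} → (∀ i → q i ≡ q′ (toℕ i)) →
               ∀ s → q ⟨ member s ⟩ ≡ part q′ (toℕ s) ℓ
  sum-member {q} {q′} q≗q′ s = sum-toℕ _ (restrict q′ (toℕ s))
    (λ i → cong₂ (if_then_else 0ℚ) (lookup-member s i) (q≗q′ i))

  sum-upTo : ∀ {q : Vector ℚ ℓ} {q′} → (∀ i → q i ≡ q′ (toℕ i)) →
             ∀ i → load q ⟨ upTo i ⟩ ≡ Σ< (weighted q′) (suc (toℕ i))
  sum-upTo {q} {q′} q≗q′ i = begin
    load q ⟨ upTo i ⟩
      ≡⟨ sum-toℕ _ below (λ j → cong₂ (if_then_else 0ℚ) (lookup∘tabulate _ j)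
           (cong₂ _*_ (sym (trans (cong weights (toArray-toℕ j)) (toArray-toℕ (memberOf j)))) (q≗q′ j))) ⟩
    Σ< below ℓ
      -- `upTo i` contains `i` itself, hence the length `suc (toℕ i)`.
      ≡⟨ Σ<-extend (toℕ<n i) (λ j i<j _ → if-no (j ℕ.≤? toℕ i) (ℕ.<⇒≱ i<j)) ⟩
    Σ< below (suc (toℕ i))
      ≡⟨ Σ<-cong (suc (toℕ i)) (λ j j≤i → if-yes (j ℕ.≤? toℕ i) (s≤s⁻¹ j≤i)) ⟩
    Σ< (weighted q′) (suc (toℕ i)) ∎
    where
    open ≡-Reasoning
    below : ℕ → ℚ
    below j = if does (j ℕ.≤? toℕ i) then weighted q′ j else 0ℚ

  -- If the labels of `a` and `b` differed, the pairs `a, c` and `b, e` would realise the first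
  -- alternative of `Interleaving`.
  non-crossing : ∀ {a b c e} → a ℕ.< b → b ℕ.< c → c ℕ.< e → e ℕ.< ℓ →
                 cls a ≡ cls c → cls b ≡ cls e → cls a ≡ cls b
  non-crossing {a} {b} {c} {e} a<b b<c c<e e<ℓ a~c b~e with cls a ℕ.≟ cls b
  ... | yes a~b = a~b
  ... | no a≁b  = ⊥-elim (non-interleaving (memberOf a′) (memberOf b′)
    (λ eq → a≁b (trans (cls-fromℕ< a<ℓ) (trans (cong toℕ eq) (sym (cls-fromℕ< b<ℓ)))))
    (a′ , c′ , b′ , e′ ,
     ( proj₂ (covering a′)
     , same a<ℓ c<ℓ a~c
     , proj₂ (covering b′)
     , same b<ℓ e<ℓ b~e ) ,
     inj₁ (ordered a<ℓ b<ℓ a<b , ordered b<ℓ c<ℓ b<c , ordered c<ℓ e<ℓ c<e)))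
    where
    c<ℓ = ℕ.<-trans c<e e<ℓ
    b<ℓ = ℕ.<-trans b<c c<ℓ
    a<ℓ = ℕ.<-trans a<b b<ℓ
    a′ = fromℕ< a<ℓ
    b′ = fromℕ< b<ℓ
    c′ = fromℕ< c<ℓ
    e′ = fromℕ< e<ℓ
    same : ∀ {j k} (j<ℓ : j ℕ.< ℓ) (k<ℓ : k ℕ.< ℓ) → cls j ≡ cls k →
           fromℕ< k<ℓ ∈ member (memberOf (fromℕ< j<ℓ))
    same j<ℓ k<ℓ j~k = subst (λ t → fromℕ< k<ℓ ∈ member t)
      (toℕ-injective (trans (sym (cls-fromℕ< k<ℓ)) (trans (sym j~k) (cls-fromℕ< j<ℓ))))
      (proj₂ (covering (fromℕ< k<ℓ)))
    ordered : ∀ {j k} (j<ℓ : j ℕ.< ℓ) (k<ℓ : k ℕ.< ℓ) → j ℕ.< k →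
              toℕ (fromℕ< j<ℓ) ℕ.< toℕ (fromℕ< k<ℓ)
    ordered j<ℓ k<ℓ = subst₂ ℕ._<_ (sym (toℕ-fromℕ< j<ℓ)) (sym (toℕ-fromℕ< k<ℓ))

  open Analysis ℓ size cls<size non-crossing
    -- The analysis asks for its bounds at all indices; outside the instance they hold for the
    -- default 0.
    (toArray-all (0ℚ ≤_) ≤-refl d-nonneg)
    (toArray-all (0ℚ ≤_) ≤-refl (λ i → proj₁ (proj₁ y-fractional i)))
    (toArray-all (_≤ 1ℚ) (nonNegative⁻¹ 1ℚ) (λ i → proj₂ (proj₁ y-fractional i)))
    (λ {t} t<size → trans (cong (λ t → part values t ℓ) (sym (toℕ-fromℕ< t<size)))
       (trans (sym (sum-member (sym ∘ toArray-toℕ) (fromℕ< t<size)))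
              (proj₂ y-fractional (fromℕ< t<size))))

  z : Vector ℚ ℓ
  z i = pick (toℕ i)

  z-integral : IsIntegralSelection 𝒮 z
  z-integral = (λ i → pick-01 (toℕ i)) ,
    λ s → trans (sum-member (λ _ → refl) s) (pick-total (toℕ<n s))

  discrepancy : ∀ i → D y z (upTo i) ≤ ½ * d-max
  discrepancy i = begin
    D y z (upTo i)
      ≡⟨ cong ∣_∣ (cong₂ _-_ (sum-upTo (sym ∘ toArray-toℕ) i) (sum-upTo (λ _ → refl) i)) ⟩
    ∣ Σ< (weighted values) (suc (toℕ i)) - Σ< (weighted pick) (suc (toℕ i)) ∣
      ≡⟨ cong ∣_∣ (error-difference (suc (toℕ i))) ⟨
    ∣ error (suc (toℕ i)) ∣
      ≤⟨ error-bound (toℕ<n i) ⟩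
    ½ * peak (suc (toℕ i))
      -- `0≤max d` covers both the initial peak 0 and the default weight 0 beyond `size`.
      ≤⟨ *-monoˡ-≤-nonNeg ½ (peak-lub (0≤max d) (toArray-all (_≤ d-max) (0≤max d) (≤max d)) (suc (toℕ i))) ⟩
    ½ * d-max ∎
    where open ≤-Reasoning

  initial-snapshot : Snapshot 0 0 0ℚ 0ℚ (λ _ → 0ℚ) (encode W)
  initial-snapshot = record
    { size≡    = refl
    ; index≡   = refl
    ; class≡   = λ _ → refl
    ; weight≡  = λ _ → refl
    ; value≡   = λ _ → refl
    ; picked≡  = λ _ ()
    ; blank    = λ _ _ → refl
    ; peak≡    = refl
    ; error≡   = refl
    ; balance≡ = λ _ → refl
    }

  computed : OutputsWithin Code.greedy W z (Code.iteration-cost *ℕ suc ℓ)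
  computed =
    let τ , t , ⇓τ , t≤ , S = greedy-correct initial-snapshot in
    τ , t , ⇓τ , t≤ , λ i → Snapshot.picked≡ S (toℕ i) (toℕ<n i)

mainTheorem10 : ((W : WPCS) → let open WPCS W in
    NonInterleaving 𝒮 →
    ∃[ z ] IsIntegralSelection 𝒮 z × (∀ i → D y z (upTo i) ≤ ½ * d-max))
    ×
    (∃[ P ] ∃[ c ] ((W : WPCS) → let open WPCS W in
    NonInterleaving 𝒮 →
    ∃[ z ] IsIntegralSelection 𝒮 z × (∀ i → D y z (upTo i) ≤ ½ * d-max)
    × OutputsWithin P W z (c *ℕ suc ℓ)))
mainTheorem10 =
  (λ W ni → let open Instance W ni in z , z-integral , discrepancy) ,
  Code.greedy , Code.iteration-cost , λ W ni → let open Instance W ni in z , z-integral , discrepancy , computed
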